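{- Let $G$ be a graph and $k\ge 0$ an integer. If a layout $\pi$ of $G$ has active neighborhood-width $\mathrm{anw}_\pi(G)\le k$, then there is a play of width at most $2k+2$ that constructs $G$ and in which every birth introduces a single vertex.
   Context: All graphs are finite, simple and undirected. Active neighborhood-width of a layout. A layout of $G$ is a linear order $\pi=(v_1,\dots,v_n)$ of $V(G)$; put $P_i=\{v_1,\dots,v_i\}$ for $0\le i\le n$. For $u\in P_i$ let $r_i^\pi(u)=N_G(u)\cap (V(G)\setminus P_i)$. Let $\mathcal A_i^\pi=\{r_i^\pi(u):u\in P_i\}\setminus\{\emptyset\}$. Then $\mathrm{anw}_\pi(G)=\max_i|\mathcal A_i^\pi|$. Sequential cable plays. A configuration on $G$ consists of the set of born vertices, a family $\mathcal L$ of pairwise disjoint nonempty sets of born vertices (the live cables), and a set of already placed edges; initially all are empty. With $\ell=|\mathcal L|$ the number of live cables before a move, the moves are: (i) birth$(S)$: introduces a nonempty set $S$ of fresh (not yet born) vertices of $G$ as one live cable; cost $2\ell+1$. (ii) fold$(X,Y)$: replaces two distinct live cables $X,Y$ by $X\cup Y$; cost $2\ell-1$. (iii) block$(X,Y)$: places every edge between two distinct live cables $X,Y$; legal when all these pairs are edges of $G$ and at least one has not already been placed; cost $2\ell$. (iv) clique$(X)$: places every edge inside a live cable $X$; legal when $X$ is a clique of $G$ and at least one internal edge has not already been placed; cost $2\ell$. (v) close$(X)$: removes the live cable $X$; legal when every edge of $G$ incident with a vertex of $X$ has already been placed; cost $2\ell-1$. A play (a finite sequence of legal moves from the initial configuration)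 constructs $G$ if every vertex is born, every edge of $G$ is placed, and every cable is closed. The width of a play is the maximum cost of its moves (and $0$ for the empty play on the empty graph). -}

module Defs where

open import Data.Bool.Properties using () renaming (_≟_ to _≟ᵇ_)
open import Data.Empty using () renaming (⊥ to False)
open import Data.Fin using (Fin; toℕ)
open import Data.Fin.Properties using (_≟_)
open import Data.Fin.Permutation using (Permutation′; _⟨$⟩ˡ_)
open import Data.Fin.Subset
open import Data.Fin.Subset.Properties
  using (_∈?_; nonempty?; x∈p∩q⁺; x∈p∩q⁻; x∈p∪q⁻; x∈p∪q⁺)
open import Data.List using (List; []; _∷_; length; filter; map; deduplicate; allFin)
open import Data.List.Extrema.Nat using (max)
open import Data.List.Membership.Propositional using () renaming (_∈_ to _∈ˡ_)
open import Data.List.Relation.Unary.All as All using (All; []; _∷_)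
import Data.List.Relation.Unary.All.Properties as Allₚ
open import Data.List.Relation.Unary.AllPairs using (AllPairs; []; _∷_)
import Data.List.Relation.Unary.AllPairs.Properties as AllPairsₚ
open import Data.List.Relation.Unary.Any using (here; there)
open import Data.Nat using (ℕ; suc; _+_; _*_; _∸_; _⊔_; _<?_)
open import Data.Product using (_×_; _,_; ∃; ∃₂)
open import Data.Sum using (_⊎_; inj₁; inj₂)
open import Data.Unit using () renaming (⊤ to True)
open import Data.Vec using (tabulate)
import Data.Vec.Properties as Vecₚ
open import Level using (0ℓ)
open import Relation.Binary
  using (Rel; Symmetric; Irreflexive; Decidable; DecidableEquality)
open import Relation.Binary.PropositionalEquality using (_≡_; _≢_; refl; sym)
open import Relation.Nullary using (¬_; no; does; ¬?; contradiction)
open import Relation.Nullary.Decidable using (_×-dec_; _⊎-dec_)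
open import Relation.Unary using () renaming (Decidable to Decidable₁)

private
  variable
    n : ℕ

record Graph (n : ℕ) : Set₁ where
  field
    Adj     : Rel (Fin n) 0ℓ
    adj?    : Decidable Adj
    adj-sym : Symmetric Adj
    irrefl  : Irreflexive _≡_ Adj

comprehension : {P : Fin n → Set} → Decidable₁ P → Subset n
comprehension P? = tabulate (λ v → does (P? v))

_≟ˢ_ : DecidableEquality (Subset n)
_≟ˢ_ = Vecₚ.≡-dec _≟ᵇ_

------------------------------------------------------------------------
-- Active neighborhood-width

-- π ⟨$⟩ʳ i is the vertex at position i (positions are counted from 0), and
-- π ⟨$⟩ˡ v is the position of the vertex v.
Layout : ℕ → Set
Layout n = Permutation′ n

N : Graph n → Fin n → Subset n
N G u = comprehension (Graph.adj? G u)

prefix : Layout n → Fin (suc n) → Subset n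
prefix π i = comprehension (λ v → toℕ (π ⟨$⟩ˡ v) <? toℕ i)

activeNbhd : Graph n → Layout n → Fin (suc n) → Fin n → Subset n
activeNbhd G π i u = N G u ∩ ∁ (prefix π i)

-- The set 𝒜ᵢ, listed without repetitions, so its length is its cardinality.
activeNbhds : Graph n → Layout n → Fin (suc n) → List (Subset n)
activeNbhds {n} G π i =
  deduplicate _≟ˢ_
    (filter nonempty?
      (map (activeNbhd G π i)
        (filter (_∈? prefix π i) (allFin n))))

anw : Graph n → Layout n → ℕ
anw {n} G π = max 0 (map (λ i → length (activeNbhds G π i)) (allFin (suc n)))

------------------------------------------------------------------------
-- Configurations

Disjoint : Subset n → Subset n → Set
Disjoint X Y = Empty (X ∩ Y)

-- The entries of `live` are pairwise disjoint and nonempty, hence distinct: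
-- the list represents a set of cables, and its length is the number of cables.
-- The edge set `Placed` is represented by a symmetric relation.
record Config (G : Graph n) : Set₁ where
  open Graph G
  field
    born          : Subset n
    live          : List (Subset n)
    live-disjoint : AllPairs Disjoint live
    live-nonempty : All Nonempty live
    live-born     : All (_⊆ born) live
    Placed        : Rel (Fin n) 0ℓ
    placed?       : Decidable Placed
    placed-sym    : Symmetric Placed
    placed-adj    : ∀ {u v} → Placed u v → Adj u v

  ℓ : ℕ
  ℓ = length live

initial : (G : Graph n) → Config G
initial G = record
  { born          = ⊥
  ; live          = []
  ; live-disjoint = []
  ; live-nonempty = []
  ; live-born     = []
  ; Placed        = λ _ _ → False
  ; placed?       = λ _ _ → no λ ()
  ; placed-sym    = λ ()
  ; placed-adj    = λ ()
  }

------------------------------------------------------------------------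
-- Moves

data Move {G : Graph n} (c : Config G) : Set where

  birth : (S : Subset n) → Nonempty S →
          (∀ {v} → v ∈ S → v ∉ Config.born c) →
          Move c

  fold : (X Y : Subset n) → X ∈ˡ Config.live c → Y ∈ˡ Config.live c → X ≢ Y →
         Move c

  block : (X Y : Subset n) → X ∈ˡ Config.live c → Y ∈ˡ Config.live c → X ≢ Y →
          (∀ {u v} → u ∈ X → v ∈ Y → Graph.Adj G u v) →
          (∃₂ λ u v → u ∈ X × v ∈ Y × ¬ Config.Placed c u v) →
          Move c

  clique : (X : Subset n) → X ∈ˡ Config.live c →
           (∀ {u v} → u ∈ X → v ∈ X → u ≢ v → Graph.Adj G u v) →
           (∃₂ λ u v → u ∈ X × v ∈ X × u ≢ v × ¬ Config.Placed c u v) →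
           Move c

  close : (X : Subset n) → X ∈ˡ Config.live c →
          (∀ {u v} → u ∈ X → Graph.Adj G u v → Config.Placed c u v) →
          Move c

-- Folding and closing need a live cable, so the truncated subtraction is exact.
cost : {G : Graph n} {c : Config G} → Move c → ℕ
cost {c = c} (birth _ _ _)       = 2 * Config.ℓ c + 1
cost {c = c} (fold _ _ _ _ _)    = 2 * Config.ℓ c ∸ 1
cost {c = c} (block _ _ _ _ _ _ _) = 2 * Config.ℓ c
cost {c = c} (clique _ _ _ _)    = 2 * Config.ℓ c
cost {c = c} (close _ _ _)       = 2 * Config.ℓ c ∸ 1

infixl 5 _∖_

_∖_ : List (Subset n) → Subset n → List (Subset n)
L ∖ X = filter (λ Z → ¬? (Z ≟ˢ X)) L

disjoint-sym : {X Y : Subset n} → Disjoint X Y → Disjoint Y X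
disjoint-sym {X = X} {Y} d (v , v∈) with x∈p∩q⁻ Y X v∈
... | v∈Y , v∈X = d (v , x∈p∩q⁺ (v∈X , v∈Y))

distinct⇒disjoint : {L : List (Subset n)} → AllPairs Disjoint L →
                    {X Y : Subset n} → X ∈ˡ L → Y ∈ˡ L → X ≢ Y → Disjoint X Y
distinct⇒disjoint (_ ∷ _)  (here refl) (here refl) X≢Y = contradiction refl X≢Y
distinct⇒disjoint (d ∷ _)  (here refl) (there Y∈)  _   = All.lookup d Y∈
distinct⇒disjoint (d ∷ _)  (there X∈)  (here refl) _   =
  disjoint-sym (All.lookup d X∈)
distinct⇒disjoint (_ ∷ ds) (there X∈)  (there Y∈)  X≢Y =
  distinct⇒disjoint ds X∈ Y∈ X≢Y

∖-all : {P : Subset n → Set} {L : List (Subset n)} (X : Subset n) →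
        All P L → All P (L ∖ X)
∖-all X = Allₚ.filter⁺ (λ Z → ¬? (Z ≟ˢ X))

∖-disjoint : {L : List (Subset n)} (X : Subset n) →
             AllPairs Disjoint L → AllPairs Disjoint (L ∖ X)
∖-disjoint X = AllPairsₚ.filter⁺ (λ Z → ¬? (Z ≟ˢ X))

∖-distinct : (L : List (Subset n)) (X : Subset n) → All (_≢ X) (L ∖ X)
∖-distinct L X = Allₚ.all-filter (λ Z → ¬? (Z ≟ˢ X)) L

after : {G : Graph n} {c : Config G} → Move c → Config G
after {c = c} (birth S S≢∅ fresh) = record
  { born          = born ∪ S
  ; live          = S ∷ live
  ; live-disjoint =
      All.map (λ Z⊆born (v , v∈) →
                 let v∈S , v∈Z = x∈p∩q⁻ _ _ v∈ in fresh v∈S (Z⊆born v∈Z))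
              live-born
      ∷ live-disjoint
  ; live-nonempty = S≢∅ ∷ live-nonempty
  ; live-born     =
      (λ v∈S → x∈p∪q⁺ (inj₂ v∈S))
      ∷ All.map (λ {Z} → grow {Z}) live-born
  ; Placed        = Placed
  ; placed?       = placed?
  ; placed-sym    = placed-sym
  ; placed-adj    = placed-adj
  }
  where
  open Config c

  grow : ∀ {Z} → Z ⊆ born → Z ⊆ born ∪ S
  grow Z⊆born v∈Z = x∈p∪q⁺ (inj₁ (Z⊆born v∈Z))
after {c = c} (fold X Y X∈ Y∈ X≢Y) = record
  { born          = born
  ; live          = X ∪ Y ∷ (live ∖ X ∖ Y)
  ; live-disjoint =
      All.map union-disjoint
        (All.zip
          ( ∖-all Y (∖-all X (All.tabulate (λ Z∈ → Z∈)))
          , All.zip (∖-all Y (∖-distinct live X) , ∖-distinct (live ∖ X) Y)))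
      ∷ ∖-disjoint Y (∖-disjoint X live-disjoint)
  ; live-nonempty =
      (let v , v∈X = All.lookup live-nonempty X∈ in v , x∈p∪q⁺ (inj₁ v∈X))
      ∷ ∖-all Y (∖-all X live-nonempty)
  ; live-born     = union-born ∷ ∖-all Y (∖-all X live-born)
  ; Placed        = Placed
  ; placed?       = placed?
  ; placed-sym    = placed-sym
  ; placed-adj    = placed-adj
  }
  where
  open Config c

  union-disjoint : ∀ {Z} → Z ∈ˡ live × Z ≢ X × Z ≢ Y → Disjoint (X ∪ Y) Z
  union-disjoint {Z} (Z∈ , Z≢X , Z≢Y) (v , v∈) with x∈p∩q⁻ (X ∪ Y) Z v∈
  ... | v∈X∪Y , v∈Z with x∈p∪q⁻ X Y v∈X∪Y
  ... | inj₁ v∈X = distinct⇒disjoint live-disjoint Z∈ X∈ Z≢X (v , x∈p∩q⁺ (v∈Z , v∈X))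
  ... | inj₂ v∈Y = distinct⇒disjoint live-disjoint Z∈ Y∈ Z≢Y (v , x∈p∩q⁺ (v∈Z , v∈Y))

  union-born : X ∪ Y ⊆ born
  union-born v∈ with x∈p∪q⁻ X Y v∈
  ... | inj₁ v∈X = All.lookup live-born X∈ v∈X
  ... | inj₂ v∈Y = All.lookup live-born Y∈ v∈Y
after {G = G} {c} (block X Y _ _ _ complete _) = record
  { born          = born
  ; live          = live
  ; live-disjoint = live-disjoint
  ; live-nonempty = live-nonempty
  ; live-born     = live-born
  ; Placed        = λ u v → Placed u v ⊎ (u ∈ X × v ∈ Y) ⊎ (u ∈ Y × v ∈ X)
  ; placed?       = λ u v → placed? u v
                      ⊎-dec (u ∈? X ×-dec v ∈? Y)
                      ⊎-dec (u ∈? Y ×-dec v ∈? X)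
  ; placed-sym    = λ where
      (inj₁ p)                 → inj₁ (placed-sym p)
      (inj₂ (inj₁ (u∈X , v∈Y))) → inj₂ (inj₂ (v∈Y , u∈X))
      (inj₂ (inj₂ (u∈Y , v∈X))) → inj₂ (inj₁ (v∈X , u∈Y))
  ; placed-adj    = λ where
      (inj₁ p)                 → placed-adj p
      (inj₂ (inj₁ (u∈X , v∈Y))) → complete u∈X v∈Y
      (inj₂ (inj₂ (u∈Y , v∈X))) → Graph.adj-sym G (complete v∈X u∈Y)
  }
  where open Config c
after {c = c} (clique X _ complete _) = record
  { born          = born
  ; live          = live
  ; live-disjoint = live-disjoint
  ; live-nonempty = live-nonempty
  ; live-born     = live-born
  ; Placed        = λ u v → Placed u v ⊎ (u ∈ X × v ∈ X × u ≢ v)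
  ; placed?       = λ u v → placed? u v
                      ⊎-dec (u ∈? X ×-dec v ∈? X ×-dec ¬? (u ≟ v))
  ; placed-sym    = λ where
      (inj₁ p)                   → inj₁ (placed-sym p)
      (inj₂ (u∈X , v∈X , u≢v)) → inj₂ (v∈X , u∈X , λ v≡u → u≢v (sym v≡u))
  ; placed-adj    = λ where
      (inj₁ p)                   → placed-adj p
      (inj₂ (u∈X , v∈X , u≢v)) → complete u∈X v∈X u≢v
  }
  where open Config c
after {c = c} (close X _ _) = record
  { born          = born
  ; live          = live ∖ X
  ; live-disjoint = ∖-disjoint X live-disjoint
  ; live-nonempty = ∖-all X live-nonempty
  ; live-born     = ∖-all X live-born
  ; Placed        = Placed
  ; placed?       = placed?
  ; placed-sym    = placed-sym
  ; placed-adj    = placed-adj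
  }
  where open Config c

------------------------------------------------------------------------
-- Plays

infixr 5 _∷_

data PlayFrom {G : Graph n} (c : Config G) : Set where
  []  : PlayFrom c
  _∷_ : (m : Move c) → PlayFrom (after m) → PlayFrom c

Play : Graph n → Set
Play G = PlayFrom (initial G)

final : {G : Graph n} {c : Config G} → PlayFrom c → Config G
final {c = c} [] = c
final (_ ∷ p)    = final p

width : {G : Graph n} {c : Config G} → PlayFrom c → ℕ
width []      = 0
width (m ∷ p) = cost m ⊔ width p

Constructs : (G : Graph n) → Play G → Set
Constructs G p =
    (∀ v → v ∈ born)
  × (∀ {u v} → Graph.Adj G u v → Placed u v)
  × live ≡ []
  where open Config (final p)

BirthIsSingle : {G : Graph n} {c : Config G} → Move c → Set
BirthIsSingle (birth S _ _)         = ∃ λ v → S ≡ ⁅ v ⁆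
BirthIsSingle (fold _ _ _ _ _)      = True
BirthIsSingle (block _ _ _ _ _ _ _) = True
BirthIsSingle (clique _ _ _ _)      = True
BirthIsSingle (close _ _ _)         = True

SingleBirths : {G : Graph n} {c : Config G} → PlayFrom c → Set
SingleBirths []      = True
SingleBirths (m ∷ p) = BirthIsSingle m × SingleBirths p

{-# OPTIONS --safe #-}
-- Between two vertices of the layout, keep exactly one live cable for each
-- nonempty active neighborhood of the current prefix, so ℓ ≤ k.  For the next
-- vertex v, birth {v} costs at most 2k + 1; then ℓ ≤ k + 1, and every cable is
-- either completely joined to v or completely non-adjacent to it, so the edges
-- from v are placed by blocks of cost at most 2k + 2.  Cables that now
-- see the same vertices outside the prefix are folded, and those that see none
-- are closed.
module Submission where

open import Defs
open import Data.Fin using (Fin; zero; suc; toℕ; fromℕ; inject₁)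
open import Data.Fin.Induction using (>-weakInduction)
open import Data.Fin.Permutation using (_⟨$⟩ʳ_; _⟨$⟩ˡ_; inverseˡ; inverseʳ)
open import Data.Fin.Properties
  using (any?; toℕ-injective; toℕ-inject₁; toℕ-fromℕ; toℕ<n)
open import Data.Fin.Subset using
  (Subset; _∈_; _∉_; _⊆_; _∪_; _∩_; ∁; ⁅_⁆; Nonempty; Empty)
open import Data.Fin.Subset.Properties using
  ( _∈?_; nonempty?; x∈⁅x⁆; x∈⁅y⁆⇒x≡y; ⊆-antisym; ∉⊥; x∈∁p⇒x∉p; x∉p⇒x∈∁p
  ; x∈p∩q⁺; x∈p∩q⁻; x∈p∪q⁺; x∈p∪q⁻ )
open import Data.List using (List; []; _∷_; length; map)
open import Data.List.Extrema.Nat using (xs≤max)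
open import Data.List.Membership.Propositional
  using (find; lose) renaming (_∈_ to _∈ˡ_)
open import Data.List.Membership.Propositional.Properties
  using (∈-map⁺; ∈-map⁻; ∈-filter⁺; ∈-filter⁻; ∈-deduplicate⁺; ∈-allFin)
open import Data.List.Properties using (filter-notAll; length-map)
open import Data.List.Relation.Unary.All as All using (All; []; _∷_; all?)
open import Data.List.Relation.Unary.All.Properties
  using (¬Any⇒All¬; ¬All⇒Any¬) renaming (map⁺ to All-map⁺)
open import Data.List.Relation.Unary.AllPairs using (AllPairs; []; _∷_)
open import Data.List.Relation.Unary.Any as Any using (here; there)
open import Data.List.Relation.Unary.Unique.Propositional using (Unique)
open import Data.Nat
  using (ℕ; suc; _+_; _*_; _≤_; _<_; _<?_; z≤n; s≤s; s≤s⁻¹)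
open import Data.Nat.Induction using (<-wellFounded)
open import Data.Nat.Properties
  using ( ≤-trans; ≤-reflexive; <⇒≤; m<n⇒m<1+n; m≤n⇒m<n∨m≡n
        ; <-irrefl; m∸n≤m; *-monoʳ-≤; +-monoˡ-≤; +-monoʳ-≤; *-distribˡ-+; ⊔-lub
        ; n≤1+n; +-comm; ≤-<-trans )
open import Data.Product using (_×_; _,_; ∃; ∃₂; proj₁; proj₂)
open import Data.Sum using (_⊎_; inj₁; inj₂)
open import Data.Unit using (tt)
open import Data.Vec.Properties using (lookup∘tabulate; lookup⇒[]=; []=⇒lookup)
open import Induction.WellFounded using (Acc; acc)
open import Relation.Binary using (DecidableEquality)
open import Relation.Binary.PropositionalEquality
  using (_≡_; _≢_; refl; sym; trans; cong; subst)
open import Relation.Nullary using (yes; no; does; ¬?; contradiction)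
open import Relation.Nullary.Decidable
  using (_×-dec_; dec-true; decidable-stable)
open import Relation.Unary using () renaming (Decidable to Decidable₁)

private
  variable
    n : ℕ

-- Comprehensions and duplicate-free lists.

∈-comprehension⁺ : {P : Fin n → Set} (P? : Decidable₁ P) →
                   ∀ {v} → P v → v ∈ comprehension P?
∈-comprehension⁺ P? {v} p =
  lookup⇒[]= v _ (trans (lookup∘tabulate _ v) (dec-true (P? v) p))

∈-comprehension⁻ : {P : Fin n → Set} (P? : Decidable₁ P) →
                   ∀ {v} → v ∈ comprehension P? → P v
∈-comprehension⁻ P? {v} v∈
  with P? v | trans (sym (lookup∘tabulate (λ w → does (P? w)) v)) ([]=⇒lookup v∈)
... | yes p | _  = p
... | no _  | ()

module _ {A : Set} (_≟_ : DecidableEquality A) where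

  -- Filtering `x` out of `ys` removes at least one entry, while the tail of `xs`, which avoids `x`,
  -- stays inside what is left.
  Unique-⊆⇒length≤ : {xs ys : List A} → Unique xs →
                     (∀ {x} → x ∈ˡ xs → x ∈ˡ ys) → length xs ≤ length ys
  Unique-⊆⇒length≤ [] _ = z≤n
  Unique-⊆⇒length≤ {x ∷ xs} {ys} (x∉xs ∷ uxs) xs⊆ys = ≤-trans
    (s≤s (Unique-⊆⇒length≤ uxs λ y∈xs →
      ∈-filter⁺ ≢x? (xs⊆ys (there y∈xs)) λ y≡x → All.lookup x∉xs y∈xs (sym y≡x)))
    (filter-notAll ≢x? ys (lose (xs⊆ys (here refl)) λ x≢x → x≢x refl))
    where
    ≢x? : Decidable₁ (_≢ x)
    ≢x? y = ¬? (y ≟ x)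

  -- The failing case yields explicit witnesses: they are the pair of cables to be folded.
  Unique-map⊎collision : {B : Set} (f : B → A) {xs : List B} → Unique xs →
    Unique (map f xs) ⊎ ∃₂ λ x y → x ∈ˡ xs × y ∈ˡ xs × x ≢ y × f x ≡ f y
  Unique-map⊎collision f [] = inj₁ []
  Unique-map⊎collision f {x ∷ xs} (x∉xs ∷ uxs) with Unique-map⊎collision f uxs
  ... | inj₂ (y , z , y∈ , z∈ , y≢z , eq) =
    inj₂ (y , z , there y∈ , there z∈ , y≢z , eq)
  ... | inj₁ ufxs with Any.any? (λ y → f x ≟ f y) xs
  ...   | no ∄  = inj₁ (All-map⁺ (¬Any⇒All¬ xs ∄) ∷ ufxs)
  ...   | yes p with find p
  ...     | y , y∈ , eq = inj₂ (x , y , here refl , there y∈ , All.lookup x∉xs y∈ , eq)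

length-∖ : {L : List (Subset n)} {X : Subset n} → X ∈ˡ L → length (L ∖ X) < length L
length-∖ {L = L} X∈ = filter-notAll _ L (lose X∈ λ X≢X → X≢X refl)

∈-∖⁺ : {L : List (Subset n)} {X Y : Subset n} → Y ∈ˡ L → Y ≢ X → Y ∈ˡ L ∖ X
∈-∖⁺ = ∈-filter⁺ _

∈-∖⁻ : {L : List (Subset n)} {X Y : Subset n} → Y ∈ˡ L ∖ X → Y ∈ˡ L × Y ≢ X
∈-∖⁻ = ∈-filter⁻ _

-- A nonempty set is never disjoint from itself.
Disjoint⇒Unique : {L : List (Subset n)} →
                  AllPairs Disjoint L → All Nonempty L → Unique L
Disjoint⇒Unique [] [] = []
Disjoint⇒Unique (d ∷ ds) ((v , v∈X) ∷ nes) =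
  All.map (λ { X⊥X refl → X⊥X (v , x∈p∩q⁺ (v∈X , v∈X)) }) d ∷ Disjoint⇒Unique ds nes

-- Plays from a configuration, and the invariant on live cables.

module _ (G : Graph n) where
  open Graph G
  open Config

  private
    variable
      c : Config G
      P X Y : Subset n
      v : Fin n
      w : ℕ

  -- The middle component is `Constructs` for a play with an arbitrary start; at `initial G` with
  -- `w` equal to `2 * k + 2` this is the conclusion of the theorem.
  Finishable : ℕ → Config G → Set
  Finishable w c = ∃ λ (p : PlayFrom c) →
    ( (∀ v → v ∈ born (final p))
    × (∀ {u v} → Adj u v → Placed (final p) u v)
    × live (final p) ≡ [] )
    × width p ≤ w × SingleBirths p

  play : (m : Move c) → cost m ≤ w → BirthIsSingle m →
         Finishable w (after m) → Finishable w c
  play m m≤w single (p , done , p≤w , singles) =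
    m ∷ p , done , ⊔-lub m≤w p≤w , single , singles

  -- One implication suffices: `u` and `u′` can be swapped, so all vertices of `X` have the same
  -- neighbors outside `P`.
  Uniform : Subset n → Subset n → Set
  Uniform P X = ∀ {u u′ v} → u ∈ X → u′ ∈ X → v ∉ P → Adj u v → Adj u′ v

  -- The demand is limited to vertices with a neighbor outside `P`, so that finished cables can be
  -- closed.
  Covered : List (Subset n) → Subset n → Set
  Covered L P = ∀ {u v} → u ∈ P → v ∉ P → Adj u v → ∃ λ X → X ∈ˡ L × u ∈ X

  record Invariant (P : Subset n) (c : Config G) : Set where
    field
      born≡   : born c ≡ P
      uniform : All (Uniform P) (live c)
      covered : Covered (live c) P
      placed  : ∀ {u v} → u ∈ P → v ∈ P → Adj u v → Placed c u v

    live⊆ : X ∈ˡ live c → X ⊆ P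
    live⊆ X∈ u∈X = subst (_ ∈_) born≡ (All.lookup (live-born c) X∈ u∈X)

  sees? : ∀ P X → Decidable₁ λ v → (∃ λ u → u ∈ X × Adj u v) × v ∉ P
  sees? P X v = any? (λ u → u ∈? X ×-dec adj? u v) ×-dec ¬? (v ∈? P)

  -- Taken over all of `X`, so that no representative has to be chosen; for a `Uniform` set it is
  -- the active neighborhood of each member.
  outer : Subset n → Subset n → Subset n
  outer P X = comprehension (sees? P X)

  outer⁺ : ∀ {u v} → u ∈ X → Adj u v → v ∉ P → v ∈ outer P X
  outer⁺ {X} {P} u∈X uv v∉P = ∈-comprehension⁺ (sees? P X) ((_ , u∈X , uv) , v∉P)

  outer⁻ : ∀ {v} → v ∈ outer P X → (∃ λ u → u ∈ X × Adj u v) × v ∉ P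
  outer⁻ {P} {X} = ∈-comprehension⁻ (sees? P X)

  outer≡N∩∁ : Uniform P X → ∀ {u} → u ∈ X → outer P X ≡ N G u ∩ ∁ P
  outer≡N∩∁ uni {u} u∈X = ⊆-antisym
    (λ v∈ → let (_ , u′∈X , u′v) , v∉P = outer⁻ v∈ in
      x∈p∩q⁺ (∈-comprehension⁺ (adj? u) (uni u′∈X u∈X v∉P u′v) , x∉p⇒x∈∁p v∉P))
    (λ v∈ → let v∈N , v∈∁P = x∈p∩q⁻ _ _ v∈ in
      outer⁺ u∈X (∈-comprehension⁻ (adj? u) v∈N) (x∈∁p⇒x∉p v∈∁P))

  -- The two added conditions make `outer P` an injection from the live cables into the nonempty
  -- active neighborhoods of `P`, which bounds `ℓ c`.
  record Reduced (P : Subset n) (c : Config G) : Set where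
    field
      invariant : Invariant P c
      seeing    : All (λ X → Nonempty (outer P X)) (live c)
      distinct  : Unique (map (outer P) (live c))

    open Invariant invariant public

  -- Closing and folding cables.

  close-invariant : (inv : Invariant P c) (X∈ : X ∈ˡ live c) → Empty (outer P X) →
    ∃ λ (legal : ∀ {u v} → u ∈ X → Adj u v → Placed c u v) →
      Invariant P (after {c = c} (close X X∈ legal))
  close-invariant {P} {c} {X} inv X∈ ∅ = legal , record
    { born≡   = born≡
    ; uniform = ∖-all X uniform
    ; covered = covered′
    ; placed  = placed
    }
    where
    open Invariant inv

    -- A neighbor outside `P` would lie in the empty outer set, so every edge at `X` runs inside
    -- `P`, where all edges are placed.
    legal : ∀ {u v} → u ∈ X → Adj u v → Placed c u v
    legal {v = v} u∈X uv with v ∈? P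
    ... | yes v∈P = placed (live⊆ X∈ u∈X) v∈P uv
    ... | no v∉P  = contradiction (v , outer⁺ u∈X uv v∉P) ∅

    covered′ : Covered (live c ∖ X) P
    covered′ u∈P v∉P uv with covered u∈P v∉P uv
    ... | Z , Z∈ , u∈Z =
      Z , ∈-∖⁺ Z∈ (λ { refl → ∅ (_ , outer⁺ u∈Z uv v∉P) }) , u∈Z

  -- Within a uniform cable the outer set determines what each vertex sees, so equal outer sets keep
  -- the union uniform.
  fold-invariant : Invariant P c → (X∈ : X ∈ˡ live c) (Y∈ : Y ∈ˡ live c) (X≢Y : X ≢ Y) →
    outer P X ≡ outer P Y → Invariant P (after {c = c} (fold X Y X∈ Y∈ X≢Y))
  fold-invariant {P} {c} {X} {Y} inv X∈ Y∈ X≢Y eq = record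
    { born≡   = born≡
    ; uniform = uniform-∪ ∷ ∖-all Y (∖-all X uniform)
    ; covered = covered′
    ; placed  = placed
    }
    where
    open Invariant inv

    -- The equality gives some vertex of `Z′` that sees `v`; uniformity of `Z′` passes this on to
    -- `u′`.
    transfer : ∀ {Z Z′} → Z′ ∈ˡ live c → outer P Z ≡ outer P Z′ → ∀ {u u′ v} →
               u ∈ Z → u′ ∈ Z′ → v ∉ P → Adj u v → Adj u′ v
    transfer Z′∈ eq u∈Z u′∈Z′ v∉P uv
      with outer⁻ (subst (_ ∈_) eq (outer⁺ u∈Z uv v∉P))
    ... | (_ , u″∈Z′ , u″v) , _ = All.lookup uniform Z′∈ u″∈Z′ u′∈Z′ v∉P u″v

    uniform-∪ : Uniform P (X ∪ Y)
    uniform-∪ u∈ u′∈ with x∈p∪q⁻ X Y u∈ | x∈p∪q⁻ X Y u′∈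
    ... | inj₁ u∈X | inj₁ u′∈X = transfer X∈ refl u∈X u′∈X
    ... | inj₁ u∈X | inj₂ u′∈Y = transfer Y∈ eq u∈X u′∈Y
    ... | inj₂ u∈Y | inj₁ u′∈X = transfer X∈ (sym eq) u∈Y u′∈X
    ... | inj₂ u∈Y | inj₂ u′∈Y = transfer Y∈ refl u∈Y u′∈Y

    covered′ : Covered (X ∪ Y ∷ (live c ∖ X ∖ Y)) P
    covered′ u∈P v∉P uv with covered u∈P v∉P uv
    ... | Z , Z∈ , u∈Z with Z ≟ˢ X | Z ≟ˢ Y
    ...   | yes refl | _        = _ , here refl , x∈p∪q⁺ (inj₁ u∈Z)
    ...   | no _     | yes refl = _ , here refl , x∈p∪q⁺ (inj₂ u∈Z)
    ...   | no Z≢X   | no Z≢Y   = Z , there (∈-∖⁺ (∈-∖⁺ Z∈ Z≢X) Z≢Y) , u∈Z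

  -- Every close or fold lowers the number of cables, so the process stops and no cost exceeds the
  -- initial bound. A play is built from its first move on, hence the rest of the play enters as the
  -- continuation `k`.
  reduce : ∀ c → Acc _<_ (ℓ c) → 2 * ℓ c ≤ w → Invariant P c →
           (∀ c′ → Reduced P c′ → Finishable w c′) → Finishable w c
  reduce {w} {P} c (acc rec) 2ℓ≤w inv k
    with all? (λ X → nonempty? (outer P X)) (live c)
  ... | no ¬seeing with find (¬All⇒Any¬ (λ X → nonempty? (outer P X)) _ ¬seeing)
  ...   | X , X∈ , ∅ with close-invariant inv X∈ ∅
  ...     | legal , inv′ =
    play (close X X∈ legal) (≤-trans (m∸n≤m (2 * ℓ c) 1) 2ℓ≤w) tt
      (reduce _ (rec ℓ′<ℓ) (≤-trans (*-monoʳ-≤ 2 (<⇒≤ ℓ′<ℓ)) 2ℓ≤w) inv′ k)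
    where
    ℓ′<ℓ : length (live c ∖ X) < ℓ c
    ℓ′<ℓ = length-∖ X∈
  reduce {w} {P} c (acc rec) 2ℓ≤w inv k | yes seeing
    with Unique-map⊎collision _≟ˢ_ (outer P)
           (Disjoint⇒Unique (live-disjoint c) (live-nonempty c))
  ... | inj₁ distinct =
    k c (record { invariant = inv ; seeing = seeing ; distinct = distinct })
  ... | inj₂ (X , Y , X∈ , Y∈ , X≢Y , eq) =
    play (fold X Y X∈ Y∈ X≢Y) (≤-trans (m∸n≤m (2 * ℓ c) 1) 2ℓ≤w) tt
      (reduce _ (rec ℓ′<ℓ) (≤-trans (*-monoʳ-≤ 2 (<⇒≤ ℓ′<ℓ)) 2ℓ≤w)
        (fold-invariant inv X∈ Y∈ X≢Y eq) k)
    where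
    -- The `suc` counts the new cable `X ∪ Y`. Since `Y` survives the removal of `X`, both removals
    -- shorten the list.
    ℓ′<ℓ : suc (length (live c ∖ X ∖ Y)) < ℓ c
    ℓ′<ℓ = ≤-<-trans (length-∖ (∈-∖⁺ Y∈ λ Y≡X → X≢Y (sym Y≡X))) (length-∖ X∈)

  -- Birth of the next vertex and placement of its edges.

  join : ∀ (Xs : List (Subset n)) c → 2 * ℓ c ≤ w → ⁅ v ⁆ ∈ˡ live c →
    (∀ {X} → X ∈ˡ Xs → X ∈ˡ live c × v ∉ X) →
    (∀ {X u u′} → X ∈ˡ Xs → u ∈ X → u′ ∈ X → Adj u v → Adj u′ v) →
    (∀ c′ → born c′ ≡ born c → live c′ ≡ live c →
      (∀ {x y} → Placed c x y → Placed c′ x y) →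
      (∀ {X u} → X ∈ˡ Xs → u ∈ X → Adj u v → Placed c′ u v) → Finishable w c′) →
    Finishable w c
  join [] c _ _ _ _ k = k c refl refl (λ p → p) λ ()
  join {w} {v} (X ∷ Xs) c 2ℓ≤w v∈live Xs⊆ uni k
    -- A block is legal only if it places a new edge; a cable with no unplaced edge to `v` is
    -- skipped.
    with any? (λ u → u ∈? X ×-dec adj? u v ×-dec ¬? (placed? c u v))
  ... | no ∄ = join Xs c 2ℓ≤w v∈live (λ Z∈ → Xs⊆ (there Z∈)) (λ Z∈ → uni (there Z∈))
    λ c′ b≡ l≡ Placed⊆ joined → k c′ b≡ l≡ Placed⊆ λ where
      (here refl) u∈X uv → Placed⊆ (decidable-stable (placed? c _ _)
                             λ ¬p → ∄ (_ , u∈X , uv , ¬p))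
      (there Z∈)         → joined Z∈
  ... | yes (u , u∈X , uv , ¬p) =
    play (block X ⁅ v ⁆ X∈ v∈live X≢⁅v⁆ complete (u , v , u∈X , x∈⁅x⁆ v , ¬p)) 2ℓ≤w tt
      (join Xs _ 2ℓ≤w v∈live (λ Z∈ → Xs⊆ (there Z∈)) (λ Z∈ → uni (there Z∈))
        λ c′ b≡ l≡ Placed⊆ joined → k c′ b≡ l≡ (λ p → Placed⊆ (inj₁ p)) λ where
          (here refl) u′∈X _ → Placed⊆ (inj₂ (inj₁ (u′∈X , x∈⁅x⁆ v)))
          (there Z∈)         → joined Z∈)
    where
    X∈ : X ∈ˡ live c
    X∈ = proj₁ (Xs⊆ (here refl))

    X≢⁅v⁆ : X ≢ ⁅ v ⁆
    X≢⁅v⁆ refl = proj₂ (Xs⊆ (here refl)) (x∈⁅x⁆ v)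

    -- The single neighbor `u` of `v` found in `X` forces all of `X` to be adjacent to `v`.
    complete : ∀ {x y} → x ∈ X → y ∈ ⁅ v ⁆ → Adj x y
    complete x∈X y∈ with x∈⁅y⁆⇒x≡y v y∈
    ... | refl = uni (here refl) u∈X x∈X uv

  -- After the birth there are `suc (ℓ c)` cables, so the first hypothesis is exactly the cost of a
  -- block; it also dominates the birth and the reduction that follows.
  extend : 2 * suc (ℓ c) ≤ w → v ∉ P → Invariant P c →
           (∀ c′ → Reduced (P ∪ ⁅ v ⁆) c′ → Finishable w c′) → Finishable w c
  extend {c} {w} {v} {P} cost≤w v∉P inv k =
    play (birth ⁅ v ⁆ (v , x∈⁅x⁆ v) fresh) birth≤w (v , refl)
      (join (live c) _ cost≤w (here refl)
        (λ X∈ → there X∈ , λ v∈X → v∉P (live⊆ X∈ v∈X))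
        -- Since `v` lies outside the old prefix, uniformity with respect to `P` makes each old
        -- cable all or nothing at `v`.
        (λ X∈ u∈X u′∈X → All.lookup uniform X∈ u∈X u′∈X v∉P)
        λ c′ b≡ l≡ Placed⊆ joined →
          reduce c′ (<-wellFounded _) (subst (λ L → 2 * length L ≤ w) (sym l≡) cost≤w)
            (invariant′ c′ b≡ l≡ Placed⊆ joined) k)
    where
    open Invariant inv

    fresh : ∀ {x} → x ∈ ⁅ v ⁆ → x ∉ born c
    fresh x∈ x∈born with x∈⁅y⁆⇒x≡y v x∈
    ... | refl = v∉P (subst (v ∈_) born≡ x∈born)

    birth≤w : 2 * ℓ c + 1 ≤ w
    birth≤w = ≤-trans (+-monoʳ-≤ (2 * ℓ c) (n≤1+n 1))
      (≤-trans (≤-reflexive (trans (+-comm (2 * ℓ c) 2) (sym (*-distribˡ-+ 2 1 (ℓ c)))))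
        cost≤w)

    P⁺ : Subset n
    P⁺ = P ∪ ⁅ v ⁆

    ∉P : ∀ {x} → x ∉ P⁺ → x ∉ P
    ∉P x∉ x∈P = x∉ (x∈p∪q⁺ (inj₁ x∈P))

    shrink : Uniform P X → Uniform P⁺ X
    shrink uni x∈X x′∈X y∉P⁺ = uni x∈X x′∈X (∉P y∉P⁺)

    uniform-⁅v⁆ : Uniform P⁺ ⁅ v ⁆
    uniform-⁅v⁆ u∈ u′∈ _ uy with x∈⁅y⁆⇒x≡y v u∈ | x∈⁅y⁆⇒x≡y v u′∈
    ... | refl | refl = uy

    covered′ : Covered (⁅ v ⁆ ∷ live c) P⁺
    covered′ x∈ y∉ xy with x∈p∪q⁻ P ⁅ v ⁆ x∈
    ... | inj₂ x∈⁅v⁆ = _ , here refl , x∈⁅v⁆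
    ... | inj₁ x∈P with covered x∈P (∉P y∉) xy
    ...   | X , X∈ , x∈X = X , there X∈ , x∈X

    invariant′ : ∀ c′ → born c′ ≡ born c ∪ ⁅ v ⁆ → live c′ ≡ ⁅ v ⁆ ∷ live c →
      (∀ {x y} → Placed c x y → Placed c′ x y) →
      (∀ {X u} → X ∈ˡ live c → u ∈ X → Adj u v → Placed c′ u v) → Invariant P⁺ c′
    invariant′ c′ b≡ l≡ Placed⊆ joined = record
      { born≡   = trans b≡ (cong (_∪ ⁅ v ⁆) born≡)
      ; uniform = subst (All (Uniform P⁺)) (sym l≡)
          (uniform-⁅v⁆ ∷ All.map (λ {X} → shrink {X}) uniform)
      ; covered = subst (λ L → Covered L P⁺) (sym l≡) covered′
      ; placed  = placed′
      }
      where
      -- No edge at `v` is missed: `v` itself is a neighbor of `x` outside `P`, so `x` lies in an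
      -- old live cable, and that cable has been joined to `v`.
      placed-v : ∀ {x} → x ∈ P → Adj x v → Placed c′ x v
      placed-v x∈P xv with covered x∈P v∉P xv
      ... | X , X∈ , x∈X = joined X∈ x∈X xv

      placed′ : ∀ {x y} → x ∈ P⁺ → y ∈ P⁺ → Adj x y → Placed c′ x y
      placed′ x∈ y∈ xy with x∈p∪q⁻ P ⁅ v ⁆ x∈ | x∈p∪q⁻ P ⁅ v ⁆ y∈
      ... | inj₁ x∈P | inj₁ y∈P = Placed⊆ (placed x∈P y∈P xy)
      ... | inj₁ x∈P | inj₂ y∈v with x∈⁅y⁆⇒x≡y v y∈v
      ...   | refl = placed-v x∈P xy
      placed′ x∈ y∈ xy | inj₂ x∈v | inj₁ y∈P with x∈⁅y⁆⇒x≡y v x∈v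
      ... | refl = placed-sym c′ (placed-v y∈P (adj-sym xy))
      placed′ x∈ y∈ xy | inj₂ x∈v | inj₂ y∈v
        with x∈⁅y⁆⇒x≡y v x∈v | x∈⁅y⁆⇒x≡y v y∈v
      ... | refl | refl = contradiction xy (irrefl refl)

  -- Every cable of a reduced configuration sees a vertex outside `P`. Here there is none, so no
  -- cable is live and the empty play suffices.
  finished : (∀ v → v ∈ P) → Reduced P c → Finishable w c
  finished {P} {c} full red =
      []
    , ( (λ v → subst (v ∈_) (sym born≡) (full v)) , placed (full _) (full _)
      , none (live c) seeing )
    , z≤n , tt
    where
    open Reduced red

    none : ∀ L → All (λ X → Nonempty (outer P X)) L → L ≡ []
    none []       []            = refl
    none (X ∷ _) ((v , v∈) ∷ _) = contradiction (full v) (proj₂ (outer⁻ {P = P} {X} v∈))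

  -- Prefixes of the layout and the induction along it.

  module _ (π : Layout n) where

    position<? : ∀ m → Decidable₁ λ v → toℕ (π ⟨$⟩ˡ v) < m
    position<? m v = toℕ (π ⟨$⟩ˡ v) <? m

    prefix-zero : born (initial G) ≡ prefix π zero
    prefix-zero = ⊆-antisym (λ v∈⊥ → contradiction v∈⊥ ∉⊥)
      (λ v∈ → contradiction (∈-comprehension⁻ (position<? 0) v∈) λ ())

    prefix-fromℕ : ∀ v → v ∈ prefix π (fromℕ n)
    prefix-fromℕ v = ∈-comprehension⁺ (position<? _)
      (subst (toℕ (π ⟨$⟩ˡ v) <_) (sym (toℕ-fromℕ n)) (toℕ<n (π ⟨$⟩ˡ v)))

    position-ʳ : ∀ i → toℕ (π ⟨$⟩ˡ (π ⟨$⟩ʳ i)) ≡ toℕ i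
    position-ʳ i = cong toℕ (inverseˡ π)

    prefix-fresh : ∀ i → π ⟨$⟩ʳ i ∉ prefix π (inject₁ i)
    prefix-fresh i v∈ = <-irrefl (trans (position-ʳ i) (sym (toℕ-inject₁ i)))
      (∈-comprehension⁻ (position<? _) v∈)

    -- Positions count from 0, so the vertex at position `i` is the first one missing from the
    -- prefix of size `i`, whose index is `inject₁ i`.
    prefix-suc : ∀ i → prefix π (inject₁ i) ∪ ⁅ π ⟨$⟩ʳ i ⁆ ≡ prefix π (suc i)
    prefix-suc i = ⊆-antisym to from
      where
      to : prefix π (inject₁ i) ∪ ⁅ π ⟨$⟩ʳ i ⁆ ⊆ prefix π (suc i)
      to v∈ with x∈p∪q⁻ (prefix π (inject₁ i)) _ v∈
      ... | inj₁ v∈P = ∈-comprehension⁺ (position<? _) (m<n⇒m<1+n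
        (subst (_ <_) (toℕ-inject₁ i) (∈-comprehension⁻ (position<? _) v∈P)))
      ... | inj₂ v∈⁅⁆ with x∈⁅y⁆⇒x≡y _ v∈⁅⁆
      ...   | refl = ∈-comprehension⁺ (position<? _) (s≤s (≤-reflexive (position-ʳ i)))

      from : prefix π (suc i) ⊆ prefix π (inject₁ i) ∪ ⁅ π ⟨$⟩ʳ i ⁆
      from v∈ with m≤n⇒m<n∨m≡n (s≤s⁻¹ (∈-comprehension⁻ (position<? _) v∈))
      ... | inj₁ <i = x∈p∪q⁺ (inj₁ (∈-comprehension⁺ (position<? _)
        (subst (_ <_) (sym (toℕ-inject₁ i)) <i)))
      ... | inj₂ ≡i = x∈p∪q⁺ (inj₂ (subst (λ x → _ ∈ ⁅ x ⁆)
        (trans (sym (inverseʳ π)) (cong (π ⟨$⟩ʳ_) (toℕ-injective ≡i))) (x∈⁅x⁆ _)))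

    activeNbhds-length : ∀ i → length (activeNbhds G π i) ≤ anw G π
    activeNbhds-length i = All.lookup (xs≤max 0 _) (∈-map⁺ _ (∈-allFin i))

    -- The outer sets of the cables are distinct and nonempty, and each is the active neighborhood
    -- of any vertex of its cable.
    reduced-ℓ : ∀ i → Reduced (prefix π i) c → ℓ c ≤ anw G π
    reduced-ℓ {c} i red = ≤-trans
      (subst (_≤ _) (length-map (outer Q) (live c))
        (Unique-⊆⇒length≤ _≟ˢ_ distinct active))
      (activeNbhds-length i)
      where
      open Reduced red

      Q : Subset n
      Q = prefix π i

      active : ∀ {A} → A ∈ˡ map (outer Q) (live c) → A ∈ˡ activeNbhds G π i
      active A∈ with ∈-map⁻ (outer Q) A∈
      ... | X , X∈ , refl with All.lookup (live-nonempty c) X∈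
      ...   | u , u∈X = ∈-deduplicate⁺ _≟ˢ_ (∈-filter⁺ nonempty?
        (subst (_∈ˡ _) (sym (outer≡N∩∁ (All.lookup uniform X∈) u∈X))
          (∈-map⁺ (activeNbhd G π i) (∈-filter⁺ (_∈? Q) (∈-allFin u) (live⊆ X∈ u∈X))))
        (All.lookup seeing X∈))

    -- Induction runs down from the full prefix, since finishing from one prefix uses finishing from
    -- the next. It covers all reduced `c` at once, because the configuration reached there depends
    -- on the moves made.
    reduced-finishable : ∀ {k} → anw G π ≤ k → ∀ i c →
                         Reduced (prefix π i) c → Finishable (2 * k + 2) c
    reduced-finishable {k} anw≤k = >-weakInduction _
      (λ _ → finished prefix-fromℕ)
      (λ i next c red → extend (cost≤ (reduced-ℓ (inject₁ i) red)) (prefix-fresh i)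
        (Reduced.invariant red)
        λ c′ red′ → next c′ (subst (λ P → Reduced P c′) (prefix-suc i) red′))
      where
      cost≤ : ∀ {l} → l ≤ anw G π → 2 * suc l ≤ 2 * k + 2
      cost≤ {l} l≤ = ≤-trans (≤-reflexive (trans (*-distribˡ-+ 2 1 l) (+-comm 2 (2 * l))))
        (+-monoˡ-≤ 2 (*-monoʳ-≤ 2 (≤-trans l≤ anw≤k)))

    initial-reduced : Reduced (prefix π zero) (initial G)
    initial-reduced = record
      { invariant = record
        { born≡   = prefix-zero
        ; uniform = []
        ; covered = λ u∈ → contradiction u∈ nothing
        ; placed  = λ u∈ → contradiction u∈ nothing
        }
      ; seeing   = []
      ; distinct = []
      }
      where
      nothing : ∀ {u} → u ∉ prefix π zero
      nothing u∈ = ∉⊥ (subst (_ ∈_) (sym prefix-zero) u∈)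

proposition3p5 : ∀ {n : ℕ} (G : Graph n) (k : ℕ) (π : Layout n) →
    anw G π ≤ k →
    ∃ λ (p : Play G) →
      Constructs G p × width p ≤ 2 * k + 2 × SingleBirths p
proposition3p5 G k π anw≤k =
  reduced-finishable G π anw≤k zero (initial G) (initial-reduced G π)
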